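{- Let $\Gamma$ be a distance-regular graph with valency $k$ and diameter $D\geq 2$, and let $\alpha=\lceil \frac{k}{a_1+1}\rceil$. Then $$c_2-1\geq \frac{\alpha(a_1+1)-k}{\binom{\alpha}{2}},$$ and if equality holds then $\Gamma$ is a Terwilliger graph.
   Context: A connected graph $\Gamma$ of diameter $D$ is distance-regular if there are integers $b_i,c_i$ ($0\le i\le D$) such that for any two vertices $x,y$ at distance $i$, exactly $c_i$ neighbours of $y$ are at distance $i-1$ from $x$ and exactly $b_i$ neighbours of $y$ are at distance $i+1$ from $x$. Then $\Gamma$ is regular of valency $k=b_0$, and $a_i:=k-b_i-c_i$. A Terwilliger graph is a connected non-complete graph such that for any two vertices $u,v$ at distance two, the subgraph induced on their common neighbours is a clique of size $\mu$, for some fixed $\mu\geq 1$. -}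

module Defs where

open import Data.Fin.Base using (Fin)
open import Data.Fin.Properties using (any?) renaming (_≟_ to _≟ꟳ_)
open import Data.Fin.Subset using (Subset; _∈_; ∣_∣)
open import Data.Integer.Base as ℤ using (+_)
open import Data.Nat.Base using (ℕ; zero; suc; _∸_; _≤_; _<_)
open import Data.Nat.Properties using (allUpTo?)
open import Data.Product.Base using (∃-syntax; _×_)
open import Data.Rational.Base as ℚ using (ceiling)
open import Data.Vec.Base using (tabulate)
open import Level using (0ℓ)
open import Relation.Binary.Core using (Rel)
open import Relation.Binary.Definitions using (Decidable; Symmetric; Irreflexive)
open import Relation.Binary.PropositionalEquality using (_≡_; _≢_)
open import Relation.Nullary.Decidable using (does; _×-dec_; ¬?)
open import Relation.Nullary.Negation using (¬_)
import Relation.Unary as U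

record Graph (n : ℕ) : Set₁ where
  infix 4 _~_ _~?_
  field
    _~_      : Rel (Fin n) 0ℓ
    _~?_     : Decidable _~_
    ~-sym    : Symmetric _~_
    ~-irrefl : Irreflexive _≡_ _~_

separate : ∀ {n} {P : U.Pred (Fin n) 0ℓ} → U.Decidable P → Subset n
separate P? = tabulate (λ z → does (P? z))

module _ {n : ℕ} (Γ : Graph n) where
  open Graph Γ

  Walk : ℕ → Rel (Fin n) 0ℓ
  Walk zero    x y = x ≡ y
  Walk (suc m) x y = ∃[ z ] (x ~ z × Walk m z y)

  walk? : ∀ m → Decidable (Walk m)
  walk? zero    x y = x ≟ꟳ y
  walk? (suc m) x y = any? (λ z → (x ~? z) ×-dec walk? m z y)

  -- Dist i x y: the length of a shortest walk from x to y is i.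
  Dist : ℕ → Rel (Fin n) 0ℓ
  Dist i x y = Walk i x y × (∀ {j} → j < i → ¬ Walk j x y)

  dist? : ∀ i → Decidable (Dist i)
  dist? i x y = walk? i x y ×-dec allUpTo? (λ j → ¬? (walk? j x y)) i

  Connected : Set
  Connected = ∀ x y → ∃[ m ] Walk m x y

  Complete : Set
  Complete = ∀ x y → x ≢ y → x ~ y

  HasDiameter : ℕ → Set
  HasDiameter D = (∀ x y i → Dist i x y → i ≤ D) × (∃[ x ] ∃[ y ] Dist D x y)

  -- Neighbours of y at distance i from x.
  neighboursAt : ℕ → (x y : Fin n) → Subset n
  neighboursAt i x y = separate (λ z → (y ~? z) ×-dec dist? i x z)

  commonNeighbours : (u v : Fin n) → Subset n
  commonNeighbours u v = separate (λ z → (u ~? z) ×-dec (v ~? z))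

  -- Only the values b i and c i with i ≤ D are constrained; the values beyond
  -- the diameter are irrelevant.
  record DistanceRegular (D : ℕ) : Set where
    field
      connected : Connected
      diameter  : HasDiameter D
      b c       : ℕ → ℕ
      -- No vertex is at distance −1.
      c-zero    : c 0 ≡ 0
      c-suc     : ∀ i x y → Dist (suc i) x y → ∣ neighboursAt i x y ∣ ≡ c (suc i)
      b-count   : ∀ i x y → Dist i x y → ∣ neighboursAt (suc i) x y ∣ ≡ b i

    k : ℕ
    k = b 0

    -- For i ≤ D, b i and c i count disjoint sets of neighbours of a vertex of
    -- valency k, so the subtraction does not truncate.
    a : ℕ → ℕ
    a i = k ∸ b i ∸ c i

    -- The ceiling of a nonnegative rational is nonnegative, so the absolute
    -- value only converts it to ℕ.
    α : ℕ
    α = ℤ.∣ ceiling (+ k ℚ./ suc (a 1)) ∣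

  IsClique : Subset n → Set
  IsClique S = ∀ {x y} → x ∈ S → y ∈ S → x ≢ y → x ~ y

  Terwilliger : Set
  Terwilliger =
    Connected × ¬ Complete ×
    (∃[ μ ] (1 ≤ μ ×
      (∀ u v → Dist 2 u v →
        IsClique (commonNeighbours u v) × ∣ commonNeighbours u v ∣ ≡ μ)))

{-# OPTIONS --safe #-}

-- Call C y = {y} ∪ (Γ(x) ∩ Γ(y)) the ball of y in the local graph Γ(x); it has
-- a₁ + 1 elements, and by distance-regularity the balls of two non-adjacent
-- vertices of Γ(x) share at most c₂ − 1 of them, as x is a common neighbour
-- outside Γ(x). Choosing vertices of Γ(x) greedily outside the balls already
-- chosen, one never gets stuck before reaching α of them, since α − 1 balls
-- cover fewer than k vertices. The Bonferroni inequality for these α balls is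
-- α(a₁ + 1) ≤ k + (α choose 2)(c₂ − 1).
--
-- If x and w are non-adjacent common neighbours of u and v at distance two,
-- then the balls of u and v in Γ(x) miss w as well as x, so starting the greedy
-- choice with u and v makes the inequality strict.

module Submission where

open import Defs
open import Data.Empty using (⊥-elim)
open import Data.Fin.Base using (Fin)
open import Data.Fin.Properties using (any?) renaming (_≟_ to _≟ꟳ_)
open import Data.Fin.Subset using (Subset; ∣_∣; _∈_; _∉_; _⊆_; _⊂_; _∪_; _∩_; ⁅_⁆; ⊥; inside; outside; _-_)
open import Data.Fin.Subset.Properties
open import Data.Integer.Base as ℤ using (ℤ)
open import Data.Integer.DivMod as ℤ using ([n/d]*d≤n; n<s[n/ℕd]*d; div-pos-is-/ℕ)
open import Data.Integer.GCD using (gcd)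
import Data.Integer.Properties as ℤ
open import Data.Integer.Tactic.RingSolver using () renaming (solve-∀ to ℤ-solve-∀)
open import Data.Nat.Base using (ℕ; zero; suc; _+_; _*_; _∸_; _≤_; _<_; _≤′_; ≤′-refl; ≤′-step; z≤n; s≤s; NonZero; ≢-nonZero⁻¹; >-nonZero⁻¹)
open import Data.Nat.Combinatorics using (_C_; nC1≡n; nCk+nC[k+1]≡[n+1]C[k+1])
open import Data.Nat.Properties
open import Data.Nat.Tactic.RingSolver using (solve-∀)
open import Data.Product.Base using (Σ-syntax; ∃-syntax; _×_; _,_; proj₁; proj₂)
open import Data.Rational.Base as ℚ using (_≥_; _/_; ↥_; ↧_; floor; ceiling)
import Data.Rational.Properties as ℚ
open import Data.Rational.Unnormalised.Base as ℚᵘ using (mkℚᵘ; *≤*; *≡*)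
import Data.Rational.Unnormalised.Properties as ℚᵘ
open import Data.Sum.Base using (inj₁; inj₂; [_,_]′)
open import Data.Vec.Base using ([]; _∷_)
open import Data.Vec.Properties using (lookup∘tabulate; lookup⇒[]=; []=⇒lookup)
open import Function.Base using (_∘_)
open import Level using (0ℓ)
open import Relation.Binary.PropositionalEquality
open import Relation.Nullary.Decidable using (yes; no; does; dec-true; ¬?; _×-dec_)
open import Relation.Nullary.Negation using (¬_; contradiction)
import Relation.Unary as U

-- Subsets

module _ {n} {P : U.Pred (Fin n) 0ℓ} (P? : U.Decidable P) where

  ∈-separate⁺ : ∀ {z} → P z → z ∈ separate P?
  ∈-separate⁺ {z} pz = lookup⇒[]= z _ (trans (lookup∘tabulate _ z) (dec-true (P? z) pz))

  ∈-separate⁻ : ∀ {z} → z ∈ separate P? → P z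
  ∈-separate⁻ {z} z∈ with P? z | trans (sym (lookup∘tabulate (does ∘ P?) z)) ([]=⇒lookup z∈)
  ... | yes pz | _ = pz
  ... | no _   | ()

∣p∪q∣+∣p∩q∣≡∣p∣+∣q∣ : ∀ {n} (p q : Subset n) → ∣ p ∪ q ∣ + ∣ p ∩ q ∣ ≡ ∣ p ∣ + ∣ q ∣
∣p∪q∣+∣p∩q∣≡∣p∣+∣q∣ [] [] = refl
∣p∪q∣+∣p∩q∣≡∣p∣+∣q∣ (outside ∷ p) (outside ∷ q) = ∣p∪q∣+∣p∩q∣≡∣p∣+∣q∣ p q
∣p∪q∣+∣p∩q∣≡∣p∣+∣q∣ (outside ∷ p) (inside ∷ q) =
  trans (cong suc (∣p∪q∣+∣p∩q∣≡∣p∣+∣q∣ p q)) (sym (+-suc ∣ p ∣ ∣ q ∣))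
∣p∪q∣+∣p∩q∣≡∣p∣+∣q∣ (inside ∷ p) (outside ∷ q) = cong suc (∣p∪q∣+∣p∩q∣≡∣p∣+∣q∣ p q)
∣p∪q∣+∣p∩q∣≡∣p∣+∣q∣ (inside ∷ p) (inside ∷ q) = cong suc (begin
  ∣ p ∪ q ∣ + suc ∣ p ∩ q ∣   ≡⟨ +-suc _ _ ⟩
  suc (∣ p ∪ q ∣ + ∣ p ∩ q ∣) ≡⟨ cong suc (∣p∪q∣+∣p∩q∣≡∣p∣+∣q∣ p q) ⟩
  suc (∣ p ∣ + ∣ q ∣)         ≡⟨ +-suc _ _ ⟨
  ∣ p ∣ + suc ∣ q ∣           ∎)
  where open ≡-Reasoning

∣p∪q∣≤∣p∣+∣q∣ : ∀ {n} (p q : Subset n) → ∣ p ∪ q ∣ ≤ ∣ p ∣ + ∣ q ∣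
∣p∪q∣≤∣p∣+∣q∣ p q = ≤-trans (m≤m+n _ _) (≤-reflexive (∣p∪q∣+∣p∩q∣≡∣p∣+∣q∣ p q))

∣p∪q∣≡∣p∣+∣q∣ : ∀ {n} (p q : Subset n) → (∀ {z} → z ∈ p → z ∉ q) → ∣ p ∪ q ∣ ≡ ∣ p ∣ + ∣ q ∣
∣p∪q∣≡∣p∣+∣q∣ {n} p q disjoint = begin
  ∣ p ∪ q ∣             ≡⟨ +-identityʳ _ ⟨
  ∣ p ∪ q ∣ + 0         ≡⟨ cong (∣ p ∪ q ∣ +_) ∣p∩q∣≡0 ⟨
  ∣ p ∪ q ∣ + ∣ p ∩ q ∣ ≡⟨ ∣p∪q∣+∣p∩q∣≡∣p∣+∣q∣ p q ⟩
  ∣ p ∣ + ∣ q ∣         ∎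
  where
  open ≡-Reasoning
  p∩q≡⊥ : p ∩ q ≡ ⊥
  p∩q≡⊥ = ⊆-antisym (λ z∈ → let z∈p , z∈q = x∈p∩q⁻ p q z∈ in ⊥-elim (disjoint z∈p z∈q))
                    (⊥-elim ∘ ∉⊥)
  ∣p∩q∣≡0 : ∣ p ∩ q ∣ ≡ 0
  ∣p∩q∣≡0 = trans (cong ∣_∣ p∩q≡⊥) (∣⊥∣≡0 n)

∣p∣<∣q∣⇒∃∈q∉p : ∀ {n} (p q : Subset n) → ∣ p ∣ < ∣ q ∣ → ∃[ y ] (y ∈ q × y ∉ p)
∣p∣<∣q∣⇒∃∈q∉p p q ∣p∣<∣q∣ with any? (λ y → (y ∈? q) ×-dec ¬? (y ∈? p))
... | yes found = found
... | no ¬found = contradiction (p⊆q⇒∣p∣≤∣q∣ q⊆p) (<⇒≱ ∣p∣<∣q∣)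
  where
  q⊆p : q ⊆ p
  q⊆p {y} y∈q with y ∈? p
  ... | yes y∈p = y∈p
  ... | no  y∉p = contradiction (y , y∈q , y∉p) ¬found

-- Pascal's rule in the form that the Bonferroni count uses: a further ball makes `n` new pairs with
-- the `n` earlier ones.
1+nC2≡n+nC2 : ∀ n → suc n C 2 ≡ n + n C 2
1+nC2≡n+nC2 n = trans (sym (nCk+nC[k+1]≡[n+1]C[k+1] n 1)) (cong (_+ n C 2) (nC1≡n n))

-- Greedy choice of balls

module Greedy {n} (V : Subset n) (ball : Fin n → Subset n) (s t : ℕ)
  (ball⊆V      : ∀ {y} → y ∈ V → ball y ⊆ V)
  (∣ball∣≡s    : ∀ {y} → y ∈ V → ∣ ball y ∣ ≡ s)
  -- The overlap is controlled only when the later centre lies outside the earlier ball, which the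
  -- greedy choice guarantees.
  (∣ball∩∣≤t   : ∀ {y z} → y ∈ V → z ∈ V → z ∉ ball y → ∣ ball z ∩ ball y ∣ ≤ t)
  where

  -- A union of m balls; δ measures the slack in the Bonferroni inequality.
  record Packing (m δ : ℕ) : Set where
    field
      union      : Subset n
      union⊆V    : union ⊆ V
      ∣union∣≤   : ∣ union ∣ ≤ m * s
      ∣ball∩∣≤    : ∀ {y} → y ∈ V → y ∉ union → ∣ ball y ∩ union ∣ ≤ m * t
      bonferroni : m * s + δ ≤ ∣ union ∣ + (m C 2) * t

  open Packing

  empty : Packing 0 0
  empty .union        = ⊥
  empty .union⊆V      = ⊥-elim ∘ ∉⊥
  empty .∣union∣≤     = ≤-reflexive (∣⊥∣≡0 n)
  empty .∣ball∩∣≤ {y} _ _ =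
    ≤-trans (∣p∩q∣≤∣q∣ (ball y) ⊥) (≤-reflexive (∣⊥∣≡0 n))
  empty .bonferroni   = z≤n

  -- A vertex outside the new union is outside both `ball y` and the old union, so its overlaps with
  -- the two add up and no list of centres has to be kept. `ε` is the amount by which the overlap of
  -- the new ball falls short of `m * t`; once gained, it stays in `δ`.
  extend : ∀ {m δ ε y} (P : Packing m δ) → y ∈ V → y ∉ P .union →
           ∣ ball y ∩ P .union ∣ + ε ≤ m * t → Packing (suc m) (δ + ε)
  extend {y = y} P _ _ _ .union = ball y ∪ P .union
  extend {y = y} P y∈V _ _ .union⊆V z∈ =
    [ ball⊆V y∈V , P .union⊆V ]′ (x∈p∪q⁻ (ball y) (P .union) z∈)
  extend {m} {y = y} P y∈V _ _ .∣union∣≤ = begin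
    ∣ ball y ∪ P .union ∣     ≤⟨ ∣p∪q∣≤∣p∣+∣q∣ (ball y) (P .union) ⟩
    ∣ ball y ∣ + ∣ P .union ∣ ≤⟨ +-mono-≤ (≤-reflexive (∣ball∣≡s y∈V)) (P .∣union∣≤) ⟩
    s + m * s                 ∎
    where open ≤-Reasoning
  extend {m} {y = y} P y∈V _ _ .∣ball∩∣≤ {z} z∈V z∉ = begin
    ∣ ball z ∩ (ball y ∪ P .union) ∣              ≡⟨ cong ∣_∣ (∩-distribˡ-∪ (ball z) (ball y) (P .union)) ⟩
    ∣ ball z ∩ ball y ∪ ball z ∩ P .union ∣       ≤⟨ ∣p∪q∣≤∣p∣+∣q∣ (ball z ∩ ball y) (ball z ∩ P .union) ⟩
    ∣ ball z ∩ ball y ∣ + ∣ ball z ∩ P .union ∣   ≤⟨ +-mono-≤ (∣ball∩∣≤t y∈V z∈V (z∉ ∘ p⊆p∪q (P .union)))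
                                                             (P .∣ball∩∣≤ z∈V (z∉ ∘ q⊆p∪q (ball y) (P .union))) ⟩
    t + m * t                                     ∎
    where open ≤-Reasoning
  extend {m} {δ} {ε} {y} P y∈V y∉ slack .bonferroni = begin
    s + m * s + (δ + ε)              ≡⟨ rearrange₁ s (m * s) δ ε ⟩
    s + (m * s + δ) + ε              ≤⟨ +-monoˡ-≤ ε (+-monoʳ-≤ s (P .bonferroni)) ⟩
    s + (∣W∣ + (m C 2) * t) + ε      ≡⟨ rearrange₂ s ∣W∣ ((m C 2) * t) ε ⟩
    s + ∣W∣ + ε + (m C 2) * t        ≡⟨ cong (λ r → r + ∣W∣ + ε + (m C 2) * t) (∣ball∣≡s y∈V) ⟨
    ∣ ball y ∣ + ∣W∣ + ε + (m C 2) * t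
      ≡⟨ cong (λ r → r + ε + (m C 2) * t) (∣p∪q∣+∣p∩q∣≡∣p∣+∣q∣ (ball y) (P .union)) ⟨
    ∣∪∣ + ∣∩∣ + ε + (m C 2) * t      ≡⟨ cong (_+ (m C 2) * t) (+-assoc ∣∪∣ ∣∩∣ ε) ⟩
    -- The overlap and the gain `ε` together cost at most one `t` for each earlier ball; Pascal's
    -- rule absorbs these `m` terms into the binomial coefficient.
    ∣∪∣ + (∣∩∣ + ε) + (m C 2) * t    ≤⟨ +-monoˡ-≤ ((m C 2) * t) (+-monoʳ-≤ ∣∪∣ slack) ⟩
    ∣∪∣ + m * t + (m C 2) * t        ≡⟨ +-assoc ∣∪∣ (m * t) ((m C 2) * t) ⟩
    ∣∪∣ + (m * t + (m C 2) * t)      ≡⟨ cong (_+_ ∣∪∣) (*-distribʳ-+ t m (m C 2)) ⟨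
    ∣∪∣ + (m + m C 2) * t            ≡⟨ cong (λ r → ∣∪∣ + r * t) (1+nC2≡n+nC2 m) ⟨
    ∣∪∣ + (suc m C 2) * t            ∎
    where
    open ≤-Reasoning
    ∣W∣ ∣∪∣ ∣∩∣ : ℕ
    ∣W∣ = ∣ P .union ∣
    ∣∪∣ = ∣ ball y ∪ P .union ∣
    ∣∩∣ = ∣ ball y ∩ P .union ∣
    rearrange₁ : ∀ a b c d → a + b + (c + d) ≡ a + (b + c) + d
    rearrange₁ = solve-∀
    rearrange₂ : ∀ a b c d → a + (b + c) + d ≡ a + b + d + c
    rearrange₂ = solve-∀

  extendTo : ∀ {m m′ δ} → m ≤′ m′ → (∀ {i} → i < m′ → i * s < ∣ V ∣) → Packing m δ → Packing m′ δ
  extendTo ≤′-refl _ P = P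
  extendTo {m′ = suc m′} (≤′-step m≤m′) room P =
    let Q = extendTo m≤m′ (room ∘ m<n⇒m<1+n) P
        -- The `m′` balls of `Q` cover at most `m′ * s` vertices, fewer than `V` has, so a further
        -- centre is available.
        y , y∈V , y∉ = ∣p∣<∣q∣⇒∃∈q∉p (Q .union) V (≤-<-trans (Q .∣union∣≤) (room (n<1+n m′)))
    in subst (Packing (suc m′)) (+-identityʳ _)
         (extend Q y∈V y∉ (≤-trans (≤-reflexive (+-identityʳ _)) (Q .∣ball∩∣≤ y∈V y∉)))

  pair : ∀ {ε u v} → u ∈ V → v ∈ V → v ∉ ball u → ∣ ball v ∩ ball u ∣ + ε ≤ t → Packing 2 ε
  pair {ε} {u} {v} u∈V v∈V v∉ slack = extend single v∈V
    (subst (v ∉_) (sym ball∪⊥) v∉)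
    -- Against a single earlier ball the allowance `m * t` is `1 * t`, which unfolds to `t + 0`.
    (subst₂ (λ p r → ∣ ball v ∩ p ∣ + ε ≤ r) (sym ball∪⊥) (sym (+-identityʳ t)) slack)
    where
    ball∪⊥ : ball u ∪ ⊥ ≡ ball u
    ball∪⊥ = ∪-identityʳ (ball u)
    single : Packing 1 0
    single = extend empty u∈V ∉⊥
      (≤-trans (≤-reflexive (+-identityʳ _)) (empty .∣ball∩∣≤ u∈V ∉⊥))

  bound : ∀ {m δ} → Packing m δ → m * s + δ ≤ ∣ V ∣ + (m C 2) * t
  bound {m} P = ≤-trans (P .bonferroni) (+-monoˡ-≤ ((m C 2) * t) (p⊆q⇒∣p∣≤∣q∣ (P .union⊆V)))

-- Fractions and ceilings

module _ where
  open import Data.Integer.Base using (+_)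

  floor-lower : ∀ p → floor p ℤ.* ↧ p ℤ.≤ ↥ p
  floor-lower p@record{} = [n/d]*d≤n (↥ p) (↧ p)

  floor-upper : ∀ p → ↥ p ℤ.< ℤ.suc (floor p) ℤ.* ↧ p
  floor-upper p@record{} =
    subst (λ f → ↥ p ℤ.< ℤ.suc f ℤ.* ↧ p) (sym (div-pos-is-/ℕ (↥ p) (ℚ.↧ₙ p))) (n<s[n/ℕd]*d (↥ p) (ℚ.↧ₙ p))

  -- Matching on `p` lets `ceiling` unfold. Through this equation both ceiling bounds are the floor
  -- bounds at `- p` with the signs reversed.
  ceiling≡-floor- : ∀ p → ceiling p ≡ ℤ.- floor (ℚ.- p)
  ceiling≡-floor- record{} = refl

  ceiling-lower : ∀ p → ↥ p ℤ.≤ ceiling p ℤ.* ↧ p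
  ceiling-lower p = ℤ.neg-cancel-≤ (begin
    ℤ.- (ceiling p ℤ.* ↧ p)         ≡⟨ cong (λ c → ℤ.- (c ℤ.* ↧ p)) (ceiling≡-floor- p) ⟩
    ℤ.- (ℤ.- f ℤ.* ↧ p)             ≡⟨ neg-neg f (↧ p) ⟩
    f ℤ.* ↧ p                       ≡⟨ cong (f ℤ.*_) (ℚ.↧-neg p) ⟨
    f ℤ.* ↧ (ℚ.- p)                 ≤⟨ floor-lower (ℚ.- p) ⟩
    ↥ (ℚ.- p)                       ≡⟨ ℚ.↥-neg p ⟩
    ℤ.- ↥ p                         ∎)
    where
    open ℤ.≤-Reasoning
    f = floor (ℚ.- p)
    neg-neg : ∀ i j → ℤ.- (ℤ.- i ℤ.* j) ≡ i ℤ.* j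
    neg-neg = ℤ-solve-∀

  ceiling-upper : ∀ p → ℤ.pred (ceiling p) ℤ.* ↧ p ℤ.< ↥ p
  ceiling-upper p = ℤ.neg-cancel-< (begin-strict
    ℤ.- ↥ p                            ≡⟨ ℚ.↥-neg p ⟨
    ↥ (ℚ.- p)                          <⟨ floor-upper (ℚ.- p) ⟩
    ℤ.suc f ℤ.* ↧ (ℚ.- p)              ≡⟨ cong (ℤ.suc f ℤ.*_) (ℚ.↧-neg p) ⟩
    ℤ.suc f ℤ.* ↧ p                    ≡⟨ neg-pred f (↧ p) ⟩
    ℤ.- (ℤ.pred (ℤ.- f) ℤ.* ↧ p)       ≡⟨ cong (λ c → ℤ.- (ℤ.pred c ℤ.* ↧ p)) (ceiling≡-floor- p) ⟨
    ℤ.- (ℤ.pred (ceiling p) ℤ.* ↧ p)   ∎)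
    where
    open ℤ.≤-Reasoning
    f = floor (ℚ.- p)
    neg-pred : ∀ i j → (+ 1 ℤ.+ i) ℤ.* j ≡ ℤ.- ((ℤ.- + 1 ℤ.+ ℤ.- i) ℤ.* j)
    neg-pred = ℤ-solve-∀

  module _ (k s : ℕ) .{{_ : NonZero s}} where

    private
      p = + k / s
      g = gcd (+ k) (+ s)

      c : ℤ
      c = ceiling p

      -- The fraction `+ k / s` is kept in lowest terms, so its numerator and denominator are those
      -- of `k` over `s` divided by `g`. Multiplying the ceiling bounds by `g` restores `k` and `s`.
      ↧*g : ∀ i → i ℤ.* ↧ p ℤ.* g ≡ i ℤ.* + s
      ↧*g i = trans (ℤ.*-assoc i (↧ p) g) (cong (i ℤ.*_) (ℚ.↧-/ (+ k) s))

      0<g : ℤ.0ℤ ℤ.< g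
      0<g = ℤ.≤∧≢⇒< (ℤ.+≤+ z≤n) (λ 0≡g → ≢-nonZero⁻¹ s
        (ℤ.+-injective (trans (sym (ℚ.↧-/ (+ k) s)) (trans (cong (↧ p ℤ.*_) (sym 0≡g)) (ℤ.*-zeroʳ (↧ p))))))

      instance
        _ = ℤ.positive 0<g
        _ = ℤ.nonNegative (ℤ.<⇒≤ 0<g)

      lower : + k ℤ.≤ c ℤ.* + s
      lower = subst₂ ℤ._≤_ (ℚ.↥-/ (+ k) s) (↧*g c) (ℤ.*-monoʳ-≤-nonNeg g (ceiling-lower p))

      upper : ℤ.pred c ℤ.* + s ℤ.< + k
      upper = subst₂ ℤ._<_ (↧*g (ℤ.pred c)) (ℚ.↥-/ (+ k) s) (ℤ.*-monoʳ-<-pos g (ceiling-upper p))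

      0≤c : + 0 ℤ.≤ c
      -- A negative `c` would make `c * s` negative, whereas `lower` puts it above `k`.
      0≤c = ℤ.≮⇒≥ λ c<0 → ℤ.<⇒≱
        (ℤ.*-monoʳ-<-pos (+ s) {{ℤ.positive (ℤ.+<+ (>-nonZero⁻¹ s))}} c<0)
        (ℤ.≤-trans (ℤ.+≤+ z≤n) lower)

      +∣c∣≡c : + ℤ.∣ c ∣ ≡ c
      +∣c∣≡c = ℤ.0≤i⇒+∣i∣≡i 0≤c

    m≤∣⌈m/n⌉∣*n : k ≤ ℤ.∣ ceiling (+ k / s) ∣ * s
    m≤∣⌈m/n⌉∣*n = ℤ.drop‿+≤+ (subst (+ k ℤ.≤_)
      (trans (cong (ℤ._* + s) (sym +∣c∣≡c)) (sym (ℤ.pos-* ℤ.∣ c ∣ s))) lower)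

    -- This is the room condition of `extendTo`: with fewer than the ceiling many balls of size `s`,
    -- some of the `k` vertices remain uncovered.
    i<∣⌈m/n⌉∣⇒i*n<m : ∀ {i} → i < ℤ.∣ ceiling (+ k / s) ∣ → i * s < k
    i<∣⌈m/n⌉∣⇒i*n<m {i} i<c = ℤ.drop‿+<+ (begin-strict
      + (i * s)            ≡⟨ ℤ.pos-* i s ⟩
      + i ℤ.* + s          ≤⟨ ℤ.*-monoʳ-≤-nonNeg (+ s) i≤pred ⟩
      ℤ.pred c ℤ.* + s     <⟨ upper ⟩
      + k                  ∎)
      where
      open ℤ.≤-Reasoning
      i≤pred : + i ℤ.≤ ℤ.pred c
      i≤pred = ℤ.i<j⇒i≤pred[j] (subst (+ i ℤ.<_) +∣c∣≡c (ℤ.+<+ i<c))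

  -- On unnormalised fractions the order is cross multiplication by definition, so the comparison is
  -- made there and carried back.
  /-≤⁺ : ∀ i m j n .{{_ : NonZero m}} .{{_ : NonZero n}} → i ℤ.* + n ℤ.≤ j ℤ.* + m → i / m ℚ.≤ j / n
  /-≤⁺ i m@(suc m-1) j n@(suc n-1) le = ℚ.toℚᵘ-cancel-≤ (begin
    ℚ.toℚᵘ (i / m) ≃⟨ ℚ.toℚᵘ-fromℚᵘ (mkℚᵘ i m-1) ⟩
    mkℚᵘ i m-1     ≤⟨ *≤* le ⟩
    mkℚᵘ j n-1     ≃⟨ ℚ.toℚᵘ-fromℚᵘ (mkℚᵘ j n-1) ⟨
    ℚ.toℚᵘ (j / n) ∎)
    where open ℚᵘ.≤-Reasoning

  /-≡⁻ : ∀ i m j n .{{_ : NonZero m}} .{{_ : NonZero n}} → i / m ≡ j / n → i ℤ.* + n ≡ j ℤ.* + m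
  /-≡⁻ i (suc m-1) j (suc n-1) eq with ℚ.fromℚᵘ-injective {mkℚᵘ i m-1} {mkℚᵘ j n-1} eq
  ... | *≡* eq′ = eq′

  module _ (m k t d : ℕ) where

    private
      cancel-k : ∀ i j → i ℤ.- j ℤ.+ j ≡ i
      cancel-k = ℤ-solve-∀

      +[k+dt] : + (k + d * t) ≡ + t ℤ.* + d ℤ.+ + k
      +[k+dt] = begin
        + (k + d * t)            ≡⟨ cong +_ (trans (+-comm k (d * t)) (cong (_+ k) (*-comm d t))) ⟩
        + (t * d + k)            ≡⟨ cong (ℤ._+ + k) (ℤ.pos-* t d) ⟩
        + t ℤ.* + d ℤ.+ + k      ∎
        where open ≡-Reasoning

    module _ .{{_ : NonZero d}} where

      -- The greedy argument is carried out in ℕ without subtraction or division. This lemma and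
      -- `frac≡⇒≡` translate its inequality and its equality case to and from the fractions, with
      -- `m` as α(a₁ + 1), `t` as c₂ - 1 and `d` as the binomial coefficient.
      ≤⇒frac≤ : m ≤ k + d * t → (+ m ℤ.- + k) / d ℚ.≤ + t / 1
      ≤⇒frac≤ m≤ = /-≤⁺ (+ m ℤ.- + k) d (+ t) 1 (begin
        (+ m ℤ.- + k) ℤ.* + 1              ≡⟨ ℤ.*-identityʳ _ ⟩
        + m ℤ.- + k                        ≤⟨ ℤ.+-monoˡ-≤ (ℤ.- + k) (ℤ.+≤+ m≤) ⟩
        + (k + d * t) ℤ.- + k              ≡⟨ cong (ℤ._- + k) +[k+dt] ⟩
        + t ℤ.* + d ℤ.+ + k ℤ.- + k        ≡⟨ cancel (+ t ℤ.* + d) (+ k) ⟩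
        + t ℤ.* + d                        ∎)
        where
        open ℤ.≤-Reasoning
        cancel : ∀ i j → i ℤ.+ j ℤ.- j ≡ i
        cancel = ℤ-solve-∀

      frac≡⇒≡ : + t / 1 ≡ (+ m ℤ.- + k) / d → m ≡ k + d * t
      frac≡⇒≡ eq = ℤ.+-injective (begin
        + m                           ≡⟨ cancel-k (+ m) (+ k) ⟨
        + m ℤ.- + k ℤ.+ + k           ≡⟨ cong (ℤ._+ + k) (ℤ.*-identityʳ (+ m ℤ.- + k)) ⟨
        (+ m ℤ.- + k) ℤ.* + 1 ℤ.+ + k ≡⟨ cong (ℤ._+ + k) (/-≡⁻ (+ t) 1 (+ m ℤ.- + k) d eq) ⟨
        + t ℤ.* + d ℤ.+ + k           ≡⟨ +[k+dt] ⟨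
        + (k + d * t)                 ∎)
        where open ≡-Reasoning

-- Distances one and two

module _ {n} (Γ : Graph n) where
  open Graph Γ

  ~⇒≢ : ∀ {x y} → x ~ y → x ≢ y
  ~⇒≢ x~y x≡y = ~-irrefl x≡y x~y

  Walk-++ : ∀ {x y z} i {j} → Walk Γ i x y → Walk Γ j y z → Walk Γ (i + j) x z
  Walk-++ zero    refl            w′ = w′
  Walk-++ (suc i) (x′ , x~x′ , w) w′ = x′ , x~x′ , Walk-++ i w w′

  ≡⇒Dist0 : ∀ {x y} → x ≡ y → Dist Γ 0 x y
  ≡⇒Dist0 x≡y = x≡y , λ ()

  ~⇒Dist1 : ∀ {x y} → x ~ y → Dist Γ 1 x y
  ~⇒Dist1 x~y = (_ , x~y , refl) , λ { {zero} _ x≡y → ~⇒≢ x~y x≡y ; {suc _} (s≤s ()) }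

  Dist1⇒~ : ∀ {x y} → Dist Γ 1 x y → x ~ y
  Dist1⇒~ ((_ , x~y , refl) , _) = x~y

  Dist2⁺ : ∀ {x y z} → x ≢ z → ¬ x ~ z → x ~ y → y ~ z → Dist Γ 2 x z
  Dist2⁺ x≢z x≁z x~y y~z = (_ , x~y , _ , y~z , refl) , λ
    { {zero} _ x≡z → x≢z x≡z
    ; {suc zero} _ (_ , x~z , refl) → x≁z x~z
    ; {suc (suc _)} (s≤s (s≤s ())) }

  Dist2⇒≢ : ∀ {x z} → Dist Γ 2 x z → x ≢ z
  Dist2⇒≢ (_ , shortest) = shortest {0} (s≤s z≤n)

  Dist2⇒≁ : ∀ {x z} → Dist Γ 2 x z → ¬ x ~ z
  Dist2⇒≁ (_ , shortest) x~z = shortest {1} (s≤s (s≤s z≤n)) (_ , x~z , refl)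

  -- The vertex reached after two steps of a shortest walk works: a shorter walk to it, continued by
  -- the rest `w`, would undercut the distance from `x` to `y`.
  Dist2+⇒Dist2 : ∀ {i x y} → Dist Γ (2 + i) x y → ∃[ z ] Dist Γ 2 x z
  Dist2+⇒Dist2 {i} ((u , x~u , v , u~v , w) , shortest) =
    v , (u , x~u , v , u~v , refl) , λ {j} j<2 w′ →
      shortest (+-monoˡ-< i j<2) (Walk-++ j w′ w)

  ∈-neighboursAt⁺ : ∀ {i x y z} → y ~ z → Dist Γ i x z → z ∈ neighboursAt Γ i x y
  ∈-neighboursAt⁺ {i} {x} {y} y~z d = ∈-separate⁺ (λ z → (y ~? z) ×-dec dist? Γ i x z) (y~z , d)

  ∈-neighboursAt⁻ : ∀ i x y {z} → z ∈ neighboursAt Γ i x y → y ~ z × Dist Γ i x z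
  ∈-neighboursAt⁻ i x y = ∈-separate⁻ (λ z → (y ~? z) ×-dec dist? Γ i x z)

  ∈-common⁺ : ∀ {u v z} → u ~ z → v ~ z → z ∈ commonNeighbours Γ u v
  ∈-common⁺ {u} {v} u~z v~z = ∈-separate⁺ (λ z → (u ~? z) ×-dec (v ~? z)) (u~z , v~z)

  ∈-common⁻ : ∀ {u v z} → z ∈ commonNeighbours Γ u v → u ~ z × v ~ z
  ∈-common⁻ {u} {v} = ∈-separate⁻ (λ z → (u ~? z) ×-dec (v ~? z))

  common≡neighboursAt1 : ∀ u v → commonNeighbours Γ u v ≡ neighboursAt Γ 1 u v
  common≡neighboursAt1 u v = ⊆-antisym
    (λ z∈ → let u~z , v~z = ∈-common⁻ z∈ in ∈-neighboursAt⁺ v~z (~⇒Dist1 u~z))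
    (λ z∈ → let v~z , d = ∈-neighboursAt⁻ 1 u v z∈ in ∈-common⁺ (Dist1⇒~ d) v~z)

  neighbours : Fin n → Subset n
  neighbours x = separate (x ~?_)

  localBall : (x y : Fin n) → Subset n
  localBall x y = ⁅ y ⁆ ∪ commonNeighbours Γ x y

  localBall⊆neighbours : ∀ {x y} → x ~ y → localBall x y ⊆ neighbours x
  localBall⊆neighbours {x} {y} x~y z∈ = ∈-separate⁺ (x ~?_)
    ([ (λ z∈ → subst (x ~_) (sym (x∈⁅y⁆⇒x≡y y z∈)) x~y)
     , proj₁ ∘ ∈-common⁻
     ]′ (x∈p∪q⁻ ⁅ y ⁆ (commonNeighbours Γ x y) z∈))

  ∉localBall⇒Dist2 : ∀ {x y z} → x ~ y → x ~ z → z ∉ localBall x y → Dist Γ 2 y z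
  ∉localBall⇒Dist2 {x} {y} {z} x~y x~z z∉ = Dist2⁺
    (λ y≡z → z∉ (x∈p∪q⁺ (inj₁ (subst (_∈ ⁅ y ⁆) y≡z (x∈⁅x⁆ y)))))
    (λ y~z → z∉ (x∈p∪q⁺ (inj₂ (∈-common⁺ x~z y~z))))
    (~-sym x~y) x~z

  Dist2⇒∉localBall : ∀ {x y z} → Dist Γ 2 y z → z ∉ localBall x y
  Dist2⇒∉localBall {x} {y} d z∈ = [ (λ z∈ → Dist2⇒≢ d (sym (x∈⁅y⁆⇒x≡y y z∈)))
                                  , Dist2⇒≁ d ∘ proj₂ ∘ ∈-common⁻
                                  ]′ (x∈p∪q⁻ ⁅ y ⁆ (commonNeighbours Γ x y) z∈)

  localBall∩⊆common : ∀ {x y z} → Dist Γ 2 y z → localBall x z ∩ localBall x y ⊆ commonNeighbours Γ y z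
  localBall∩⊆common {x} {y} {z} d {w} w∈ with x∈p∩q⁻ (localBall x z) (localBall x y) w∈
  ... | w∈z , w∈y with x∈p∪q⁻ ⁅ z ⁆ (commonNeighbours Γ x z) w∈z | x∈p∪q⁻ ⁅ y ⁆ (commonNeighbours Γ x y) w∈y
  -- Neither centre lies in the other ball, so only genuine common neighbours of `y` and `z`
  -- survive.
  ... | inj₁ w∈⁅z⁆ | _ = ⊥-elim (Dist2⇒∉localBall d (subst (_∈ localBall x y) (x∈⁅y⁆⇒x≡y z w∈⁅z⁆) w∈y))
  ... | inj₂ w∈cz | inj₁ w∈⁅y⁆ =
    ⊥-elim (Dist2⇒≁ d (~-sym (subst (z ~_) (x∈⁅y⁆⇒x≡y y w∈⁅y⁆) (proj₂ (∈-common⁻ w∈cz)))))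
  ... | inj₂ w∈cz | inj₂ w∈cy = ∈-common⁺ (proj₂ (∈-common⁻ w∈cy)) (proj₂ (∈-common⁻ w∈cz))

  x∉localBall∩ : ∀ {x y z} → x ~ y → x ∉ localBall x z ∩ localBall x y
  x∉localBall∩ {x} {y} {z} x~y x∈ = ~-irrefl refl
    (∈-separate⁻ (x ~?_) (localBall⊆neighbours x~y (p∩q⊆q (localBall x z) (localBall x y) x∈)))

-- Counts in a distance-regular graph

module _ {n} {Γ : Graph n} {D} (dr : DistanceRegular Γ D) where
  open Graph Γ
  open DistanceRegular dr

  ∣neighbours∣≡k : ∀ x → ∣ neighbours Γ x ∣ ≡ k
  ∣neighbours∣≡k x = trans (cong ∣_∣ (⊆-antisym
    (λ z∈ → let x~z = ∈-separate⁻ (x ~?_) z∈ in ∈-neighboursAt⁺ Γ x~z (~⇒Dist1 Γ x~z))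
    (λ z∈ → ∈-separate⁺ (x ~?_) (proj₁ (∈-neighboursAt⁻ Γ 1 x x z∈)))))
    (b-count 0 x x (≡⇒Dist0 Γ refl))

  -- As `x ~ y`, every neighbour of `y` is at distance 0, 1 or 2 from `x`. These three classes have
  -- sizes `c 1`, `∣ A₁ ∣` and `b 1` and add up to `k`, so the truncated subtractions in `a 1` are
  -- exact.
  ∣common∣≡a₁ : ∀ {x y} → x ~ y → ∣ commonNeighbours Γ x y ∣ ≡ a 1
  ∣common∣≡a₁ {x} {y} x~y = sym (begin
    k ∸ b 1 ∸ c 1                              ≡⟨ cong (λ r → r ∸ b 1 ∸ c 1) k≡ ⟩
    c 1 + (∣ A₁ ∣ + b 1) ∸ b 1 ∸ c 1           ≡⟨ cong (λ r → r ∸ b 1 ∸ c 1) (+-assoc (c 1) ∣ A₁ ∣ (b 1)) ⟨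
    c 1 + ∣ A₁ ∣ + b 1 ∸ b 1 ∸ c 1             ≡⟨ cong (_∸ c 1) (m+n∸n≡m (c 1 + ∣ A₁ ∣) (b 1)) ⟩
    c 1 + ∣ A₁ ∣ ∸ c 1                         ≡⟨ m+n∸m≡n (c 1) ∣ A₁ ∣ ⟩
    ∣ A₁ ∣                                     ∎)
    where
    open ≡-Reasoning
    A₀ = neighboursAt Γ 0 x y
    A₁ = commonNeighbours Γ x y
    A₂ = neighboursAt Γ 2 x y

    split⊆ : neighbours Γ y ⊆ A₀ ∪ (A₁ ∪ A₂)
    split⊆ {z} z∈ with ∈-separate⁻ (y ~?_) z∈ | x ≟ꟳ z | x ~? z
    ... | y~z | yes x≡z | _       = x∈p∪q⁺ (inj₁ (∈-neighboursAt⁺ Γ y~z (≡⇒Dist0 Γ x≡z)))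
    ... | y~z | no _    | yes x~z = x∈p∪q⁺ (inj₂ (x∈p∪q⁺ (inj₁ (∈-common⁺ Γ x~z y~z))))
    ... | y~z | no x≢z  | no x≁z  =
      x∈p∪q⁺ (inj₂ (x∈p∪q⁺ (inj₂ (∈-neighboursAt⁺ Γ y~z (Dist2⁺ Γ x≢z x≁z x~y y~z)))))

    ⊆split : A₀ ∪ (A₁ ∪ A₂) ⊆ neighbours Γ y
    ⊆split z∈ = ∈-separate⁺ (y ~?_)
      ([ proj₁ ∘ ∈-neighboursAt⁻ Γ 0 x y
       , [ proj₂ ∘ ∈-common⁻ Γ , proj₁ ∘ ∈-neighboursAt⁻ Γ 2 x y ]′ ∘ x∈p∪q⁻ A₁ A₂
       ]′ (x∈p∪q⁻ A₀ (A₁ ∪ A₂) z∈))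

    disjoint₀ : ∀ {z} → z ∈ A₀ → z ∉ A₁ ∪ A₂
    disjoint₀ z∈A₀ z∈ = let _ , x≡z , _ = ∈-neighboursAt⁻ Γ 0 x y z∈A₀ in
      [ (λ z∈A₁ → ~⇒≢ Γ (proj₁ (∈-common⁻ Γ z∈A₁)) x≡z)
      , (λ z∈A₂ → Dist2⇒≢ Γ (proj₂ (∈-neighboursAt⁻ Γ 2 x y z∈A₂)) x≡z)
      ]′ (x∈p∪q⁻ A₁ A₂ z∈)

    disjoint₁ : ∀ {z} → z ∈ A₁ → z ∉ A₂
    disjoint₁ z∈A₁ z∈A₂ = Dist2⇒≁ Γ (proj₂ (∈-neighboursAt⁻ Γ 2 x y z∈A₂)) (proj₁ (∈-common⁻ Γ z∈A₁))

    k≡ : k ≡ c 1 + (∣ A₁ ∣ + b 1)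
    k≡ = begin
      k                             ≡⟨ ∣neighbours∣≡k y ⟨
      ∣ neighbours Γ y ∣            ≡⟨ cong ∣_∣ (⊆-antisym split⊆ ⊆split) ⟩
      ∣ A₀ ∪ (A₁ ∪ A₂) ∣            ≡⟨ ∣p∪q∣≡∣p∣+∣q∣ A₀ (A₁ ∪ A₂) disjoint₀ ⟩
      ∣ A₀ ∣ + ∣ A₁ ∪ A₂ ∣          ≡⟨ cong (_+_ ∣ A₀ ∣) (∣p∪q∣≡∣p∣+∣q∣ A₁ A₂ disjoint₁) ⟩
      ∣ A₀ ∣ + (∣ A₁ ∣ + ∣ A₂ ∣)    ≡⟨ cong₂ (λ i j → i + (∣ A₁ ∣ + j))
                                         (c-suc 0 x y (~⇒Dist1 Γ x~y)) (b-count 1 x y (~⇒Dist1 Γ x~y)) ⟩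
      c 1 + (∣ A₁ ∣ + b 1)          ∎

  ∣common∣≡c₂ : ∀ {u v} → Dist Γ 2 u v → ∣ commonNeighbours Γ u v ∣ ≡ c 2
  ∣common∣≡c₂ {u} {v} d = trans (cong ∣_∣ (common≡neighboursAt1 Γ u v)) (c-suc 1 u v d)

  ∣localBall∣≡1+a₁ : ∀ {x y} → x ~ y → ∣ localBall Γ x y ∣ ≡ suc (a 1)
  ∣localBall∣≡1+a₁ {x} {y} x~y = begin
    ∣ ⁅ y ⁆ ∪ commonNeighbours Γ x y ∣      ≡⟨ ∣p∪q∣≡∣p∣+∣q∣ ⁅ y ⁆ _ disjoint ⟩
    ∣ ⁅ y ⁆ ∣ + ∣ commonNeighbours Γ x y ∣  ≡⟨ cong₂ _+_ (∣⁅x⁆∣≡1 y) (∣common∣≡a₁ x~y) ⟩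
    suc (a 1)                               ∎
    where
    open ≡-Reasoning
    disjoint : ∀ {z} → z ∈ ⁅ y ⁆ → z ∉ commonNeighbours Γ x y
    disjoint z∈⁅y⁆ z∈ = ~⇒≢ Γ (proj₂ (∈-common⁻ Γ z∈)) (sym (x∈⁅y⁆⇒x≡y y z∈⁅y⁆))

  ∣localBall∩∣<c₂ : ∀ {x y z} → x ~ y → x ~ z → Dist Γ 2 y z →
                    ∣ localBall Γ x z ∩ localBall Γ x y ∣ < c 2
  ∣localBall∩∣<c₂ {x} {y} {z} x~y x~z d = subst (_ <_) (∣common∣≡c₂ d) (p⊂q⇒∣p∣<∣q∣
    (localBall∩⊆common Γ d , x , ∈-common⁺ Γ (~-sym x~y) (~-sym x~z) , x∉localBall∩ Γ x~y))

  -- Two of the `c 2` common neighbours of `y` and `z` are missed by the intersection: `w`, which is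
  -- not adjacent to `x`, and `x` itself. Removing `w` first leaves a set in which `x` still
  -- witnesses a proper inclusion.
  1+∣localBall∩∣<c₂ : ∀ {x w y z} → x ~ y → x ~ z → w ~ y → w ~ z → w ≢ x → ¬ x ~ w → Dist Γ 2 y z →
                      suc ∣ localBall Γ x z ∩ localBall Γ x y ∣ < c 2
  1+∣localBall∩∣<c₂ {x} {w} {y} {z} x~y x~z w~y w~z w≢x x≁w d = begin-strict
    suc ∣ I ∣       ≤⟨ p⊂q⇒∣p∣<∣q∣ I⊂ ⟩
    ∣ Y - w ∣       <⟨ x∈p⇒∣p-x∣<∣p∣ (∈-common⁺ Γ (~-sym w~y) (~-sym w~z)) ⟩
    ∣ Y ∣           ≡⟨ ∣common∣≡c₂ d ⟩
    c 2             ∎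
    where
    open ≤-Reasoning
    I = localBall Γ x z ∩ localBall Γ x y
    Y = commonNeighbours Γ y z
    w∉I : w ∉ I
    w∉I w∈ = x≁w (∈-separate⁻ (x ~?_)
      (localBall⊆neighbours Γ x~y (p∩q⊆q (localBall Γ x z) (localBall Γ x y) w∈)))
    I⊂ : I ⊂ Y - w
    I⊂ = (λ {v} v∈ → x∈p∧x∉q⇒x∈p─q (localBall∩⊆common Γ d v∈)
                       (λ v∈⁅w⁆ → w∉I (subst (_∈ I) (x∈⁅y⁆⇒x≡y w v∈⁅w⁆) v∈)))
       , x
       , x∈p∧x∉q⇒x∈p─q (∈-common⁺ Γ (~-sym x~y) (~-sym x~z)) (λ x∈⁅w⁆ → w≢x (sym (x∈⁅y⁆⇒x≡y w x∈⁅w⁆)))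
       , x∉localBall∩ Γ x~y

  -- The greedy choice in the neighbourhood of a vertex

  module LocalGreedy (x : Fin n) where

    ∈N⇒~ : ∀ {y} → y ∈ neighbours Γ x → x ~ y
    ∈N⇒~ = ∈-separate⁻ (x ~?_)

    ∣localBall∩∣≤c₂∸1 : ∀ {y z} → y ∈ neighbours Γ x → z ∈ neighbours Γ x → z ∉ localBall Γ x y →
                        ∣ localBall Γ x z ∩ localBall Γ x y ∣ ≤ c 2 ∸ 1
    ∣localBall∩∣≤c₂∸1 y∈ z∈ z∉ = let x~y = ∈N⇒~ y∈ ; x~z = ∈N⇒~ z∈ in
      <⇒≤pred (∣localBall∩∣<c₂ x~y x~z (∉localBall⇒Dist2 Γ x~y x~z z∉))

    open Greedy (neighbours Γ x) (localBall Γ x) (suc (a 1)) (c 2 ∸ 1)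
      (localBall⊆neighbours Γ ∘ ∈N⇒~)
      (∣localBall∣≡1+a₁ ∘ ∈N⇒~)
      ∣localBall∩∣≤c₂∸1
      public

    -- Any start with at most `α` balls can be completed to exactly `α`, keeping its slack `δ`. The
    -- start `empty` gives the inequality, and `pair` with slack 1 gives the strict one.
    packing⇒bound : ∀ {m δ} → m ≤ α → Packing m δ → α * suc (a 1) + δ ≤ k + (α C 2) * (c 2 ∸ 1)
    packing⇒bound m≤α P = subst (λ v → _ ≤ v + (α C 2) * (c 2 ∸ 1)) (∣neighbours∣≡k x)
      (bound (extendTo (≤⇒≤′ m≤α)
        (λ i<α → subst (_ <_) (sym (∣neighbours∣≡k x)) (i<∣⌈m/n⌉∣⇒i*n<m k (suc (a 1)) i<α)) P))

  α-bound : Fin n → α * suc (a 1) ≤ k + (α C 2) * (c 2 ∸ 1)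
  α-bound x = ≤-trans (m≤m+n _ 0) (packing⇒bound z≤n empty)
    where open LocalGreedy x

  α-bound-strict : ∀ {x w u v} → 2 ≤ α → x ~ u → x ~ v → w ~ u → w ~ v → w ≢ x → ¬ x ~ w → Dist Γ 2 u v →
                   α * suc (a 1) < k + (α C 2) * (c 2 ∸ 1)
  α-bound-strict {x} {w} 2≤α x~u x~v w~u w~v w≢x x≁w d =
    ≤-trans (≤-reflexive (sym (+-comm _ 1))) (packing⇒bound 2≤α
      (pair (∈-separate⁺ (x ~?_) x~u) (∈-separate⁺ (x ~?_) x~v) (Dist2⇒∉localBall Γ d)
        (≤-trans (≤-reflexive (+-comm _ 1)) (<⇒≤pred (1+∣localBall∩∣<c₂ x~u x~v w~u w~v w≢x x≁w d)))))
    where open LocalGreedy x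

  -- In the neighbourhood of a middle vertex `x` the ball of `u` misses `v`, so a₁ + 1 < k and one
  -- ball does not suffice. This makes room for `pair` and keeps the denominator of the theorem
  -- nonzero.
  2≤α : ∀ {u v} → Dist Γ 2 u v → 2 ≤ α
  2≤α {u} {v} d@((x , u~x , v , x~v , refl) , _) = ≰⇒> λ α≤1 → <⇒≱ 1+a₁<k (begin
    k                 ≤⟨ m≤∣⌈m/n⌉∣*n k (suc (a 1)) ⟩
    α * suc (a 1)     ≤⟨ *-monoˡ-≤ (suc (a 1)) α≤1 ⟩
    1 * suc (a 1)     ≡⟨ *-identityˡ (suc (a 1)) ⟩
    suc (a 1)         ∎)
    where
    open ≤-Reasoning
    1+a₁<k : suc (a 1) < k
    1+a₁<k = subst₂ _<_ (∣localBall∣≡1+a₁ (~-sym u~x)) (∣neighbours∣≡k x) (p⊂q⇒∣p∣<∣q∣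
      (localBall⊆neighbours Γ (~-sym u~x) , v , ∈-separate⁺ (x ~?_) x~v , Dist2⇒∉localBall Γ d))

  1≤c₂ : ∀ {u v} → Dist Γ 2 u v → 1 ≤ c 2
  1≤c₂ {u} d@((x , u~x , v , x~v , refl) , _) =
    ≤-trans (s≤s z≤n) (∣localBall∩∣<c₂ (~-sym u~x) x~v d)

  -- The given pair shows that the graph is not complete and that `2 ≤ α`. At any pair at distance
  -- two, non-adjacent distinct common neighbours would make the bound strict, so equality forces
  -- cliques, and μ is `c 2`.
  tight⇒Terwilliger : ∀ {u v} → Dist Γ 2 u v → α * suc (a 1) ≡ k + (α C 2) * (c 2 ∸ 1) → Terwilliger Γ
  tight⇒Terwilliger d tight =
    connected , (λ complete → Dist2⇒≁ Γ d (complete _ _ (Dist2⇒≢ Γ d))) ,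
    c 2 , 1≤c₂ d , λ u v d′ → clique d′ , ∣common∣≡c₂ d′
    where
    clique : ∀ {u v} → Dist Γ 2 u v → IsClique Γ (commonNeighbours Γ u v)
    clique d′ {x} {w} x∈ w∈ x≢w with x ~? w
    ... | yes x~w = x~w
    ... | no  x≁w = let u~x , v~x = ∈-common⁻ Γ x∈ ; u~w , v~w = ∈-common⁻ Γ w∈ in
      ⊥-elim (<-irrefl tight (α-bound-strict (2≤α d)
        (~-sym u~x) (~-sym v~x) (~-sym u~w) (~-sym v~w) (x≢w ∘ sym) x≁w d′))

  ∃Dist2 : 2 ≤ D → ∃[ u ] ∃[ v ] Dist Γ 2 u v
  ∃Dist2 (s≤s (s≤s _)) = let x , _ , d = proj₂ diameter in x , Dist2+⇒Dist2 Γ d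

-- From the bound in ℕ to the fractional statement

nC2-nonZero : ∀ {n} → 2 ≤ n → NonZero (n C 2)
nC2-nonZero {suc (suc n)} (s≤s (s≤s _)) = subst NonZero (sym (1+nC2≡n+nC2 (suc n))) _

open import Data.Integer.Base using (+_)

+n-1≡+[n∸1] : ∀ {n} → 1 ≤ n → + n ℤ.- + 1 ≡ + (n ∸ 1)
+n-1≡+[n∸1] (s≤s _) = refl

theorem4 : ∀ {n} (Γ : Graph n) (D : ℕ) (dr : DistanceRegular Γ D) → 2 ≤ D →
    let open DistanceRegular dr in
    Σ[ α₂≢0 ∈ NonZero (α C 2) ]
      let lhs = (+ c 2 ℤ.- + 1) / 1
          rhs = _/_ (+ (α * suc (a 1)) ℤ.- + k) (α C 2) {{α₂≢0}}
      in (lhs ≥ rhs) × (lhs ≡ rhs → Terwilliger Γ)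
theorem4 Γ D dr 2≤D with ∃Dist2 dr 2≤D
-- Since `c 2` is positive, the integer difference on the left is the natural number `c 2 ∸ 1` that
-- bounds the overlaps.
... | u , v , d rewrite +n-1≡+[n∸1] (1≤c₂ dr d) =
  nonZero ,
  ≤⇒frac≤ (α * suc (a 1)) k (c 2 ∸ 1) (α C 2) {{nonZero}} (α-bound dr u) ,
  tight⇒Terwilliger dr d ∘ frac≡⇒≡ (α * suc (a 1)) k (c 2 ∸ 1) (α C 2) {{nonZero}}
  where
  open DistanceRegular dr
  nonZero : NonZero (α C 2)
  nonZero = nC2-nonZero (2≤α dr d)
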